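{- Let $G$ be the infinite king grid. The code $C=\{(x,y)\in\mathbb{Z}^2\mid x-y\equiv 0\pmod 3\}$ is self-locating-dominating in $G$ and its density is $1/3$.
   Context: The infinite king grid $G=(V,E)$ has $V=\mathbb{Z}^2$, and distinct vertices $(u_1,u_2)$, $(v_1,v_2)$ are adjacent iff $|u_1-v_1|\le1$ and $|u_2-v_2|\le1$. Let $V_n=\{(x,y)\mid |x|\le n,|y|\le n\}$; the density of a code $C\subseteq V$ is $D(C)=\limsup_{n\to\infty}|C\cap V_n|/|V_n|$. $N[v]$ is the closed neighbourhood of $v$, and for a code $C$, $I(C;v)=N[v]\cap C$. A code $C$ is self-locating-dominating if for every $u\in V\setminus C$, $I(C;u)\ne\emptyset$ and $\bigcap_{c\in I(C;u)}N[c]=\{u\}$. -}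

module Defs where

open import Algebra.Bundles using (AbelianGroup)
open import Algebra.Properties.Group using (∙-cancelʳ)
open import Data.Integer.Base as ℤ using (ℤ; +_; -[1+_]; ∣_∣; _⊖_)
import Data.Integer.Properties as ℤ
open import Data.Integer.Divisibility using (_∣_)
open import Data.List.Base using (List; length; map; upTo; filter; cartesianProduct)
import Data.List.Membership.Propositional as List
import Data.List.Membership.Propositional.Properties as List
open import Data.List.Relation.Unary.Unique.Propositional using (Unique)
import Data.List.Relation.Unary.Unique.Propositional.Properties as Unique
open import Data.Nat.Base as ℕ using (ℕ; zero; suc)
import Data.Nat.Divisibility as ℕ
import Data.Nat.Properties as ℕ
open import Data.Product.Base using (_×_; _,_; ∃-syntax; proj₁)
open import Data.Rational.Base as ℚ using (ℚ; 0ℚ)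
open import Function.Base using (_∘_)
open import Function.Bundles using (_⇔_; mk⇔; Equivalence)
open import Level using (0ℓ)
open import Relation.Binary.Core using (Rel)
open import Relation.Binary.PropositionalEquality
open import Relation.Unary

Vertex : Set
Vertex = ℤ × ℤ

Adjacent : Rel Vertex 0ℓ
Adjacent u@(u₁ , u₂) v@(v₁ , v₂) =
  u ≢ v × ∣ u₁ ℤ.- v₁ ∣ ℕ.≤ 1 × ∣ u₂ ℤ.- v₂ ∣ ℕ.≤ 1

N[_] : Vertex → Pred Vertex 0ℓ
N[ v ] = ｛ v ｝ ∪ Adjacent v

Code : Set₁
Code = Pred Vertex 0ℓ

I : Code → Vertex → Pred Vertex 0ℓ
I C v = N[ v ] ∩ C

SelfLocatingDominating : Code → Set
SelfLocatingDominating C = ∀ u → u ∉ C →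
  Satisfiable (I C u) × ⋂ (Satisfiable (I C u)) (N[_] ∘ proj₁) ≐ ｛ u ｝

V : ℕ → Pred Vertex 0ℓ
V n (x , y) = ∣ x ∣ ℕ.≤ n × ∣ y ∣ ℕ.≤ n

-- The integers -n, …, n.
interval : ℕ → List ℤ
interval n = map (_⊖ n) (upTo (suc (n ℕ.+ n)))

box : ℕ → List Vertex
box n = cartesianProduct (interval n) (interval n)

-- box-unique and ∈-box say that box n lists every element of V n exactly once,
-- so that lengths of (filtered) boxes are cardinalities.

interval-unique : ∀ n → Unique (interval n)
interval-unique n = Unique.map⁺ inj (Unique.upTo⁺ (suc (n ℕ.+ n)))
  where
  inj : ∀ {i j} → i ⊖ n ≡ j ⊖ n → i ≡ j
  inj {i} {j} eq = ℤ.+-injective (∙-cancelʳ (AbelianGroup.group ℤ.+-0-abelianGroup) (ℤ.- (+ n)) (+ i) (+ j)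
    (trans (ℤ.m-n≡m⊖n i n) (trans eq (sym (ℤ.m-n≡m⊖n j n)))))

∈-interval : ∀ n {x} → x List.∈ interval n ⇔ ∣ x ∣ ℕ.≤ n
∈-interval n = mk⇔ to from
  where
  bound : ∀ m i → i ℕ.≤ m ℕ.+ n → m ℕ.≤ n → ∣ i ⊖ m ∣ ℕ.≤ n
  bound zero    i       i≤ m≤n = i≤
  bound (suc m) zero    i≤ m≤n = m≤n
  bound (suc m) (suc i) i≤ m≤n rewrite ℤ.[1+m]⊖[1+n]≡m⊖n i m =
    bound m i (ℕ.s≤s⁻¹ i≤) (ℕ.<⇒≤ m≤n)

  to : ∀ {x} → x List.∈ interval n → ∣ x ∣ ℕ.≤ n
  to x∈ with i , i∈ , refl ← List.∈-map⁻ (_⊖ n) x∈ =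
    bound n i (ℕ.s≤s⁻¹ (List.∈-upTo⁻ i∈)) ℕ.≤-refl

  from : ∀ {x} → ∣ x ∣ ℕ.≤ n → x List.∈ interval n
  from {+ k} k≤n = subst (List._∈ interval n)
    (trans (ℤ.⊖-≥ (ℕ.m≤n+m n k)) (cong +_ (ℕ.m+n∸n≡m k n)))
    (List.∈-map⁺ (_⊖ n) (List.∈-upTo⁺ (ℕ.s≤s (ℕ.+-monoˡ-≤ n k≤n))))
  from { -[1+ k ]} k<n = subst (List._∈ interval n)
    (trans (ℤ.⊖-≤ (ℕ.m∸n≤m n (suc k)))
      (cong (ℤ.-_ ∘ +_) (ℕ.m∸[m∸n]≡n k<n)))
    (List.∈-map⁺ (_⊖ n) (List.∈-upTo⁺
      (ℕ.s≤s (ℕ.≤-trans (ℕ.m∸n≤m n (suc k)) (ℕ.m≤m+n n n)))))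

box-unique : ∀ n → Unique (box n)
box-unique n = Unique.cartesianProduct⁺ (interval-unique n) (interval-unique n)

∈-box : ∀ n {v} → v List.∈ box n ⇔ v ∈ V n
∈-box n = mk⇔
  (λ v∈ → let x∈ , y∈ = List.∈-cartesianProduct⁻ (interval n) (interval n) v∈
          in to x∈ , to y∈)
  (λ (x≤ , y≤) → List.∈-cartesianProduct⁺ (from x≤) (from y≤))
  where open module E {x} = Equivalence (∈-interval n {x}) using (to; from)

-- |C ∩ V n| / |V n|; the code is decidable so that its elements can be counted.
ratio : (C : Code) → Decidable C → ℕ → ℚ
ratio C C? n = + length (filter C? (box n)) ℚ./ length (box n)

-- limsup a = L, for a rational L.
LimSup : (ℕ → ℚ) → ℚ → Set
LimSup a L = ∀ ε → 0ℚ ℚ.< ε →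
  (∃[ m ] ∀ n → m ℕ.≤ n → a n ℚ.< L ℚ.+ ε) ×
  (∀ m → ∃[ n ] m ℕ.≤ n × L ℚ.- ε ℚ.< a n)

HasDensity : (C : Code) → Decidable C → ℚ → Set
HasDensity C C? = LimSup (ratio C C?)

diagonalCode : Code
diagonalCode (x , y) = + 3 ∣ x ℤ.- y

diagonalCode? : Decidable diagonalCode
diagonalCode? (x , y) = 3 ℕ.∣? ∣ x ℤ.- y ∣

{-# OPTIONS --safe #-}

-- If u = (x , y) is not in the code, then 3 ∣ x - y + s for some s = ±1, so
-- (x + s , y), (x , y - s) and (x - s , y + s) are codewords around u.  A vertex
-- within distance 1 of all three lies between x - s and x + s in the first
-- coordinate and between y - s and y + s in the second, so it is u.
--
-- In every row, exactly one of three consecutive vertices is a codeword, so in a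
-- box of side l three times the number of codewords is within 4 l of l².

module Submission where

open import Defs
open import Data.Integer.Base as ℤ using (ℤ; +_; -[1+_]; ∣_∣; 0ℤ; 1ℤ; _⊖_)
open import Data.Integer.DivMod using (_/ℕ_; _%ℕ_; n%ℕd<d; a≡a%ℕn+[a/ℕn]*n)
open import Data.Integer.Divisibility.Signed as ℤ
  using (divides; ∣ᵤ⇒∣; ∣⇒∣ᵤ; ∣m∣n⇒∣m-n; ∣m+n∣m⇒∣n)
import Data.Integer.Properties as ℤ
open import Data.Integer.Tactic.RingSolver using (solve-∀)
open import Data.List.Base
  using (List; []; _∷_; _++_; length; map; upTo; applyUpTo; filter; cartesianProduct)
open import Data.List.Properties
  using (length-++; length-map; length-upTo; length-filter; filter-++; map-upTo; map-applyUpTo)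
open import Data.Nat.Base as ℕ using (ℕ; suc; s≤s; z≤n)
import Data.Nat.Divisibility as ℕ
import Data.Nat.Properties as ℕ
open import Data.Nat.Tactic.RingSolver using () renaming (solve-∀ to solveℕ-∀)
open import Data.Product.Base using (_×_; _,_; ∃-syntax; proj₁; proj₂)
open import Data.Product.Properties using (≡-dec)
open import Data.Rational.Base as ℚ using (mkℚ; 0ℚ; _/_; toℚᵘ; ↧ₙ_)
import Data.Rational.Properties as ℚ
open import Data.Rational.Unnormalised.Base as ℚᵘ using (mkℚᵘ)
import Data.Rational.Unnormalised.Properties as ℚᵘ
open import Data.Sum.Base using (_⊎_; inj₁; inj₂; [_,_])
open import Function.Base using (_∘_)
open import Level using (Level)
open import Relation.Binary.PropositionalEquality hiding ([_])
open import Relation.Nullary.Decidable using (yes; no)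
open import Relation.Nullary.Negation using (¬_; contradiction)
open import Relation.Unary using (Pred; Decidable; Satisfiable; _∈_; ⋂; _≐_; ｛_｝)

private variable
  a b p : Level
  A : Set a
  B : Set b

-- Closed neighbourhoods and self-location

∣i-i∣≤1 : ∀ i → ∣ i ℤ.- i ∣ ℕ.≤ 1
∣i-i∣≤1 i = ℕ.≤-trans (ℕ.≤-reflexive (cong ∣_∣ (ℤ.+-inverseʳ i))) z≤n

N⇒close : ∀ {u v} → v ∈ N[ u ] →
  ∣ proj₁ u ℤ.- proj₁ v ∣ ℕ.≤ 1 × ∣ proj₂ u ℤ.- proj₂ v ∣ ℕ.≤ 1
N⇒close {x , y} (inj₁ refl) = ∣i-i∣≤1 x , ∣i-i∣≤1 y
N⇒close (inj₂ (_ , close)) = close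

close⇒N : ∀ {u v} → ∣ proj₁ u ℤ.- proj₁ v ∣ ℕ.≤ 1 → ∣ proj₂ u ℤ.- proj₂ v ∣ ℕ.≤ 1 →
  v ∈ N[ u ]
close⇒N {u} {v} p q with ≡-dec ℤ._≟_ ℤ._≟_ u v
... | yes u≡v = inj₁ u≡v
... | no  u≢v = inj₂ (u≢v , p , q)

N-sym : ∀ {u v} → v ∈ N[ u ] → u ∈ N[ v ]
N-sym {u₁ , u₂} {v₁ , v₂} v∈ with p , q ← N⇒close v∈ =
  close⇒N (subst (ℕ._≤ 1) (ℤ.∣i-j∣≡∣j-i∣ u₁ v₁) p) (subst (ℕ._≤ 1) (ℤ.∣i-j∣≡∣j-i∣ u₂ v₂) q)

-- Remainder 1 is corrected by `s = -1`, remainder 2 by `s = 1`. Recording the correction as a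
-- single unit `s` lets one argument treat both kinds of non-codeword, which are mirror images of
-- each other.
residue : ∀ i → + 3 ℤ.∣ i ⊎ ∃[ s ] ∣ s ∣ ≡ 1 × + 3 ℤ.∣ i ℤ.+ s
residue i with i %ℕ 3 | n%ℕd<d i 3 | a≡a%ℕn+[a/ℕn]*n i 3
... | 0 | _ | eq = inj₁ (divides (i /ℕ 3) (trans eq (ℤ.+-identityˡ _)))
... | 1 | _ | eq = inj₂ (-[1+ 0 ] , refl ,
  divides (i /ℕ 3) (trans (cong (ℤ._+ -[1+ 0 ]) eq) (shift (i /ℕ 3))))
  where
  shift : ∀ q → + 1 ℤ.+ q ℤ.* + 3 ℤ.+ -[1+ 0 ] ≡ q ℤ.* + 3
  shift = solve-∀
... | 2 | _ | eq = inj₂ (+ 1 , refl ,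
  divides (1ℤ ℤ.+ i /ℕ 3) (trans (cong (ℤ._+ + 1) eq) (shift (i /ℕ 3))))
  where
  shift : ∀ q → + 2 ℤ.+ q ℤ.* + 3 ℤ.+ + 1 ≡ (1ℤ ℤ.+ q) ℤ.* + 3
  shift = solve-∀
... | suc (suc (suc _)) | s≤s (s≤s (s≤s ())) | _

-- If `i` is nonzero, one of the two unit steps leads away from 0 and reaches absolute value at
-- least 2.
squeeze : ∀ i s → ∣ s ∣ ≡ 1 → ∣ i ℤ.+ s ∣ ℕ.≤ 1 → ∣ i ℤ.- s ∣ ℕ.≤ 1 → i ≡ 0ℤ
squeeze (+ 0)      _        _    _        _        = refl
squeeze (+ suc k)  (+ 1)    refl (s≤s p)  _        = contradiction (ℕ.≤-trans (ℕ.m≤n+m 1 k) p) λ ()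
squeeze (+ suc k)  -[1+ 0 ] refl _        (s≤s q)  = contradiction (ℕ.≤-trans (ℕ.m≤n+m 1 k) q) λ ()
squeeze -[1+ k ]   (+ 1)    refl _        (s≤s ())
squeeze -[1+ k ]   -[1+ 0 ] refl (s≤s ()) _

module _ {C : Code} {x y s : ℤ} (∣s∣≡1 : ∣ s ∣ ≡ 1)
  (right : (x ℤ.+ s , y) ∈ C)
  (below : (x , y ℤ.- s) ∈ C)
  (corner : (x ℤ.- s , y ℤ.+ s) ∈ C)
  where

  private
    ∣s∣≤1 : ∣ s ∣ ℕ.≤ 1
    ∣s∣≤1 = ℕ.≤-reflexive ∣s∣≡1

    +s-close : ∀ i → ∣ i ℤ.+ s ℤ.- i ∣ ℕ.≤ 1
    +s-close i = subst ((ℕ._≤ 1) ∘ ∣_∣) (sym (cancel i s)) ∣s∣≤1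
      where
      cancel : ∀ i s → i ℤ.+ s ℤ.- i ≡ s
      cancel = solve-∀

    -s-close : ∀ i → ∣ i ℤ.- s ℤ.- i ∣ ℕ.≤ 1
    -s-close i = subst (ℕ._≤ 1) (trans (sym (ℤ.∣-i∣≡∣i∣ s)) (cong ∣_∣ (sym (cancel i s)))) ∣s∣≤1
      where
      cancel : ∀ i s → i ℤ.- s ℤ.- i ≡ ℤ.- s
      cancel = solve-∀

    between : ∀ i j → ∣ i ℤ.+ s ℤ.- j ∣ ℕ.≤ 1 → ∣ i ℤ.- s ℤ.- j ∣ ℕ.≤ 1 → i ≡ j
    between i j p q = ℤ.i-j≡0⇒i≡j i j (squeeze (i ℤ.- j) s ∣s∣≡1
      (subst ((ℕ._≤ 1) ∘ ∣_∣) (swap i j s) p)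
      -- `i - s` unfolds to `i + (- s)`, so the same identity serves for the other sign.
      (subst ((ℕ._≤ 1) ∘ ∣_∣) (swap i j (ℤ.- s)) q))
      where
      swap : ∀ i j s → i ℤ.+ s ℤ.- j ≡ i ℤ.- j ℤ.+ s
      swap = solve-∀

    u : Vertex
    u = x , y

    right∈I : (x ℤ.+ s , y) ∈ I C u
    right∈I = N-sym (close⇒N (+s-close x) (∣i-i∣≤1 y)) , right

    below∈I : (x , y ℤ.- s) ∈ I C u
    below∈I = N-sym (close⇒N (∣i-i∣≤1 x) (-s-close y)) , below

    corner∈I : (x ℤ.- s , y ℤ.+ s) ∈ I C u
    corner∈I = N-sym (close⇒N (-s-close x) (+s-close y)) , corner

  located : Satisfiable (I C u) ×
    (⋂ (Satisfiable (I C u)) (N[_] ∘ proj₁) ≐ ｛ u ｝)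
  -- The inclusion of `u` in the intersection is just symmetry: every `c` in `I C u` is a neighbour
  -- of `u` or `u` itself.
  located = (_ , right∈I) , only-u , λ { refl (_ , c∈N , _) → N-sym c∈N }
    where
    only-u : ∀ {v} → (∀ c → v ∈ N[ proj₁ c ]) → u ≡ v
    -- The first coordinate is pinned by `x + s` and `x - s`, the second by `y + s` and `y - s`; the
    -- corner supplies one bound in each.
    only-u {v₁ , v₂} v∈ = cong₂ _,_
      (between x v₁ (proj₁ (N⇒close (v∈ (_ , right∈I)))) (proj₁ (N⇒close (v∈ (_ , corner∈I)))))
      (between y v₂ (proj₂ (N⇒close (v∈ (_ , corner∈I)))) (proj₂ (N⇒close (v∈ (_ , below∈I)))))

diagonal-sld : SelfLocatingDominating diagonalCode
diagonal-sld (x , y) u∉ with residue (x ℤ.- y)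
... | inj₁ 3∣x-y = contradiction (∣⇒∣ᵤ 3∣x-y) u∉
... | inj₂ (s , ∣s∣≡1 , 3∣x-y+s) = located {C = diagonalCode} ∣s∣≡1
  (∣⇒∣ᵤ (subst (+ 3 ℤ.∣_) (right x y s) 3∣x-y+s))
  (∣⇒∣ᵤ (subst (+ 3 ℤ.∣_) (below x y s) 3∣x-y+s))
  -- At the corner the difference of coordinates is `x - y - 2s`, which is `x - y + s` less the
  -- multiple `3s` of 3.
  (∣⇒∣ᵤ (subst (+ 3 ℤ.∣_) (corner x y s) (∣m∣n⇒∣m-n 3∣x-y+s (divides s refl))))
  where
  right : ∀ x y s → x ℤ.- y ℤ.+ s ≡ x ℤ.+ s ℤ.- y
  right = solve-∀
  below : ∀ x y s → x ℤ.- y ℤ.+ s ≡ x ℤ.- (y ℤ.- s)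
  below = solve-∀
  corner : ∀ x y s → x ℤ.- y ℤ.+ s ℤ.- s ℤ.* + 3 ≡ x ℤ.- s ℤ.- (y ℤ.+ s)
  corner = solve-∀

-- Counting with a bounded error

-- This is `|m - n| ≤ e` without truncated subtraction, so that estimates and their errors add.
Close : ℕ → ℕ → ℕ → Set
Close e m n = m ℕ.≤ n ℕ.+ e × n ℕ.≤ m ℕ.+ e

+-mono-≤-slack : ∀ {a b c d} e f → a ℕ.≤ b ℕ.+ e → c ℕ.≤ d ℕ.+ f →
  a ℕ.+ c ℕ.≤ b ℕ.+ d ℕ.+ (e ℕ.+ f)
+-mono-≤-slack {b = b} {d = d} e f p q = ℕ.≤-trans (ℕ.+-mono-≤ p q) (ℕ.≤-reflexive (swap b e d f))
  where
  swap : ∀ b e d f → (b ℕ.+ e) ℕ.+ (d ℕ.+ f) ≡ (b ℕ.+ d) ℕ.+ (e ℕ.+ f)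
  swap = solveℕ-∀

Close-+ : ∀ {e f m n m′ n′} → Close e m n → Close f m′ n′ →
  Close (e ℕ.+ f) (m ℕ.+ m′) (n ℕ.+ n′)
Close-+ {e} {f} (p , q) (p′ , q′) = +-mono-≤-slack e f p p′ , +-mono-≤-slack e f q q′

module _ {P : Pred A p} (P? : Decidable P) where

  count : List A → ℕ
  count = length ∘ filter P?

  count-++ : ∀ xs ys → count (xs ++ ys) ≡ count xs ℕ.+ count ys
  count-++ xs ys = trans (cong length (filter-++ P? xs ys)) (length-++ (filter P? xs))

  count-one-of-three : ∀ x y z → P x ⊎ P y ⊎ P z →
    ¬ (P x × P y) → ¬ (P x × P z) → ¬ (P y × P z) → count (x ∷ y ∷ z ∷ []) ≡ 1
  count-one-of-three x y z some ¬xy ¬xz ¬yz with P? x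
  ... | yes px with P? y
  ...   | yes py = contradiction (px , py) ¬xy
  ...   | no _ with P? z
  ...     | yes pz = contradiction (px , pz) ¬xz
  ...     | no _   = refl
  count-one-of-three x y z some ¬xy ¬xz ¬yz | no ¬px with P? y
  ... | yes py with P? z
  ...   | yes pz = contradiction (py , pz) ¬yz
  ...   | no _   = refl
  count-one-of-three x y z some ¬xy ¬xz ¬yz | no ¬px | no ¬py with P? z
  ... | yes _  = refl
  ... | no ¬pz = contradiction some [ ¬px , [ ¬py , ¬pz ] ]

  -- A full block of three contributes 3 to both sides, so the error comes only from the at most two
  -- entries left over. Bounding their count by their number gives at worst 6 against 2, hence the
  -- 4. With `applyUpTo`, removing a block merely shifts `f`.
  count-applyUpTo : ∀ f → (∀ i → count (f i ∷ f (1 ℕ.+ i) ∷ f (2 ℕ.+ i) ∷ []) ≡ 1) →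
    ∀ m → Close 4 m (3 ℕ.* count (applyUpTo f m))
  count-applyUpTo f one 0 = z≤n , z≤n
  count-applyUpTo f one 1 = ℕ.≤-trans (s≤s z≤n) (ℕ.m≤n+m 4 _) ,
    ℕ.≤-trans (ℕ.*-monoʳ-≤ 3 (length-filter P? (f 0 ∷ []))) (ℕ.m≤n+m 3 2)
  count-applyUpTo f one 2 = ℕ.≤-trans (s≤s (s≤s z≤n)) (ℕ.m≤n+m 4 _) ,
    ℕ.*-monoʳ-≤ 3 (length-filter P? (f 0 ∷ f 1 ∷ []))
  count-applyUpTo f one (suc (suc (suc m))) =
    subst (λ c → Close 4 (3 ℕ.+ m) (3 ℕ.* c)) (sym split)
      (subst (Close 4 (3 ℕ.+ m)) (sym (ℕ.*-distribˡ-+ 3 1 (count rest)))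
        (Close-+ {0} {4} (ℕ.≤-refl , ℕ.≤-refl) (count-applyUpTo (f ∘ (3 ℕ.+_)) (one ∘ (3 ℕ.+_)) m)))
    where
    rest = applyUpTo (f ∘ (3 ℕ.+_)) m
    split : count (f 0 ∷ f 1 ∷ f 2 ∷ rest) ≡ 1 ℕ.+ count rest
    split = trans (count-++ (f 0 ∷ f 1 ∷ f 2 ∷ []) rest) (cong (ℕ._+ count rest) (one 0))

-- The product is the concatenation of its rows, each with a fixed first coordinate; counts and
-- errors add up over them.
count-cartesianProduct : {P : Pred (A × B) p} (P? : Decidable P) → ∀ {e m} k ys →
  (∀ x → Close e m (k ℕ.* count P? (map (x ,_) ys))) →
  ∀ xs → Close (length xs ℕ.* e) (length xs ℕ.* m) (k ℕ.* count P? (cartesianProduct xs ys))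
count-cartesianProduct P? k ys row [] = z≤n , ℕ.≤-reflexive (ℕ.*-zeroʳ k)
count-cartesianProduct P? {e} {m} k ys row (x ∷ xs) =
  subst (Close _ _)
    (sym (trans (cong (k ℕ.*_) (count-++ P? (map (x ,_) ys) (cartesianProduct xs ys)))
                (ℕ.*-distribˡ-+ k (count P? (map (x ,_) ys)) _)))
    (Close-+ {e} {length xs ℕ.* e} (row x) (count-cartesianProduct P? k ys row xs))

-- With `x` fixed, the difference of coordinates runs through three consecutive integers, decreasing
-- by 1 at each vertex.
diagonal-window : ∀ x n i →
  count diagonalCode? ((x , i ⊖ n) ∷ (x , suc i ⊖ n) ∷ (x , suc (suc i) ⊖ n) ∷ []) ≡ 1
diagonal-window x n i = count-one-of-three diagonalCode?
  (x , i ⊖ n) (x , suc i ⊖ n) (x , suc (suc i) ⊖ n) some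
  (apart i 1 ℕ.≤-refl (s≤s (s≤s z≤n)))
  (apart i 2 (s≤s z≤n) ℕ.≤-refl)
  (apart (suc i) 1 ℕ.≤-refl (s≤s (s≤s z≤n)))
  where
  δ : ℕ → ℤ
  δ j = x ℤ.- (j ⊖ n)

  δ-+ : ∀ k j → δ j ≡ δ (k ℕ.+ j) ℤ.+ + k
  δ-+ k j = begin
    x ℤ.- (j ⊖ n)                            ≡⟨ cong (λ d → x ℤ.- d) (ℤ.m-n≡m⊖n j n) ⟨
    x ℤ.- (+ j ℤ.- + n)                      ≡⟨ regroup x (+ j) (+ k) (+ n) ⟩
    x ℤ.- (+ (k ℕ.+ j) ℤ.- + n) ℤ.+ + k      ≡⟨ cong (λ d → x ℤ.- d ℤ.+ + k) (ℤ.m-n≡m⊖n (k ℕ.+ j) n) ⟩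
    x ℤ.- ((k ℕ.+ j) ⊖ n) ℤ.+ + k            ∎
    where
    open ≡-Reasoning
    regroup : ∀ x j k n → x ℤ.- (j ℤ.- n) ≡ x ℤ.- (k ℤ.+ j ℤ.- n) ℤ.+ k
    regroup = solve-∀

  apart : ∀ j k → 1 ℕ.≤ k → k ℕ.< 3 →
    ¬ (diagonalCode (x , j ⊖ n) × diagonalCode (x , (k ℕ.+ j) ⊖ n))
  -- The two differences are `k` apart (here `suc k`), so 3 would divide a number strictly between 0
  -- and 3.
  apart j (suc k) _ k<3 (3∣δj , 3∣δk+j) = ℕ.>⇒∤ k<3 (∣⇒∣ᵤ (∣m+n∣m⇒∣n
    (subst (+ 3 ℤ.∣_) (δ-+ (suc k) j) (∣ᵤ⇒∣ {i = δ j} 3∣δj)) (∣ᵤ⇒∣ {i = δ (suc k ℕ.+ j)} 3∣δk+j)))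

  some : diagonalCode (x , i ⊖ n) ⊎ diagonalCode (x , suc i ⊖ n) ⊎ diagonalCode (x , suc (suc i) ⊖ n)
  -- The residue is taken at the middle vertex: `s = 1` points to the vertex before it, `s = -1` to
  -- the one after.
  some with residue (δ (suc i))
  ... | inj₁ 3∣ = inj₂ (inj₁ (∣⇒∣ᵤ 3∣))
  ... | inj₂ (+ 1 , refl , 3∣) = inj₁ (∣⇒∣ᵤ (subst (+ 3 ℤ.∣_) (sym (δ-+ 1 i)) 3∣))
  ... | inj₂ (-[1+ 0 ] , refl , 3∣) = inj₂ (inj₂ (∣⇒∣ᵤ (subst (+ 3 ℤ.∣_) back 3∣)))
    where
    cancel : ∀ d → d ℤ.+ + 1 ℤ.- + 1 ≡ d
    cancel = solve-∀
    back : δ (suc i) ℤ.- + 1 ≡ δ (suc (suc i))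
    back = trans (cong (λ d → d ℤ.- + 1) (δ-+ 1 (suc i))) (cancel (δ (suc (suc i))))

-- Codewords in a box

side : ℕ → ℕ
side n = suc (n ℕ.+ n)

length-interval : ∀ n → length (interval n) ≡ side n
length-interval n = trans (length-map (_⊖ n) (upTo (side n))) (length-upTo (side n))

length-cartesianProduct : (xs : List A) (ys : List B) →
  length (cartesianProduct xs ys) ≡ length xs ℕ.* length ys
length-cartesianProduct []       ys = refl
length-cartesianProduct (x ∷ xs) ys = trans (length-++ (map (x ,_) ys))
  (cong₂ ℕ._+_ (length-map (x ,_) ys) (length-cartesianProduct xs ys))

length-box : ∀ n → length (box n) ≡ side n ℕ.* side n
length-box n = trans (length-cartesianProduct (interval n) (interval n))
  (cong₂ ℕ._*_ (length-interval n) (length-interval n))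

diagonal-row : ∀ n x → Close 4 (side n) (3 ℕ.* count diagonalCode? (map (x ,_) (interval n)))
diagonal-row n x = subst (λ vs → Close 4 (side n) (3 ℕ.* count diagonalCode? vs))
  (sym (trans (cong (map (x ,_)) (map-upTo (_⊖ n) (side n))) (map-applyUpTo (_⊖ n) (x ,_) (side n))))
  (count-applyUpTo diagonalCode? (λ i → x , i ⊖ n) (diagonal-window x n) (side n))

diagonal-box : ∀ n → Close (side n ℕ.* 4) (length (box n)) (3 ℕ.* count diagonalCode? (box n))
diagonal-box n = subst (λ l → Close (side n ℕ.* 4) l (3 ℕ.* count diagonalCode? (box n))) (sym (length-box n))
  (subst (λ l → Close (l ℕ.* 4) (l ℕ.* side n) (3 ℕ.* count diagonalCode? (box n))) (length-interval n)
    (count-cartesianProduct diagonalCode? 3 (interval n) (diagonal-row n) (interval n)))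

-- Rational estimates and the density

-- An error estimate in which the two fractions can be exchanged: it gives both
-- a n < L + ε and L < a n + ε without subtraction.
/-<-/+ε : ∀ i m j n e {ε} .{{_ : ℕ.NonZero m}} .{{_ : ℕ.NonZero n}} → 0ℚ ℚ.< ε →
  i ℕ.* n ℕ.≤ j ℕ.* m ℕ.+ e → e ℕ.* ↧ₙ ε ℕ.< m ℕ.* n → + i / m ℚ.< + j / n ℚ.+ ε
/-<-/+ε i m j n e {mkℚ (+ 0)      _ _} (ℚ.*<* (ℤ.+<+ ()))
/-<-/+ε i m j n e {mkℚ -[1+ _ ]   _ _} (ℚ.*<* ())
/-<-/+ε i m@(suc m-1) j n@(suc n-1) e {ε@(mkℚ (+ p@(suc _)) q-1 _)} _ in≤jm+e eq<mn =
  -- Among unnormalised rationals the sum is an explicit fraction, and the inequality becomes the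
  -- cross-multiplied `cross` in the natural numbers.
  ℚ.toℚᵘ-cancel-< (begin-strict
    toℚᵘ (+ i / m)                 ≃⟨ ℚ.toℚᵘ-fromℚᵘ (mkℚᵘ (+ i) m-1) ⟩
    mkℚᵘ (+ i) m-1                 <⟨ ℚᵘ.*<* (subst₂ ℤ._<_ lhs rhs (ℤ.+<+ cross)) ⟩
    mkℚᵘ (+ j) n-1 ℚᵘ.+ toℚᵘ ε     ≃⟨ ℚᵘ.+-congˡ (toℚᵘ ε) (ℚ.toℚᵘ-fromℚᵘ (mkℚᵘ (+ j) n-1)) ⟨
    toℚᵘ (+ j / n) ℚᵘ.+ toℚᵘ ε     ≃⟨ ℚ.toℚᵘ-homo-+ (+ j / n) ε ⟨
    toℚᵘ (+ j / n ℚ.+ ε)           ∎)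
  where
  open ℚᵘ.≤-Reasoning
  q = suc q-1

  cross : i ℕ.* (n ℕ.* q) ℕ.< (j ℕ.* q ℕ.+ p ℕ.* n) ℕ.* m
  cross = R.begin-strict
    i ℕ.* (n ℕ.* q)                         R.≡⟨ ℕ.*-assoc i n q ⟨
    i ℕ.* n ℕ.* q                           R.≤⟨ ℕ.*-monoˡ-≤ q in≤jm+e ⟩
    (j ℕ.* m ℕ.+ e) ℕ.* q                   R.≡⟨ ℕ.*-distribʳ-+ q (j ℕ.* m) e ⟩
    j ℕ.* m ℕ.* q ℕ.+ e ℕ.* q               R.<⟨ ℕ.+-monoʳ-< (j ℕ.* m ℕ.* q) eq<mn ⟩
    -- The numerator `p` is at least 1, so `ε` is at least `1 / q`; a bound on the error in terms of
    -- the denominator therefore suffices.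
    j ℕ.* m ℕ.* q ℕ.+ m ℕ.* n               R.≤⟨ ℕ.+-monoʳ-≤ (j ℕ.* m ℕ.* q) (ℕ.m≤n*m (m ℕ.* n) p) ⟩
    j ℕ.* m ℕ.* q ℕ.+ p ℕ.* (m ℕ.* n)       R.≡⟨ regroup j m q p n ⟩
    (j ℕ.* q ℕ.+ p ℕ.* n) ℕ.* m             R.∎
    where
    module R = ℕ.≤-Reasoning
    regroup : ∀ j m q p n → j ℕ.* m ℕ.* q ℕ.+ p ℕ.* (m ℕ.* n) ≡ (j ℕ.* q ℕ.+ p ℕ.* n) ℕ.* m
    regroup = solveℕ-∀

  lhs : + (i ℕ.* (n ℕ.* q)) ≡ + i ℤ.* + (n ℕ.* q)
  lhs = ℤ.pos-* i (n ℕ.* q)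

  rhs : + ((j ℕ.* q ℕ.+ p ℕ.* n) ℕ.* m) ≡ (+ j ℤ.* + q ℤ.+ + p ℤ.* + n) ℤ.* + m
  rhs = trans (ℤ.pos-* (j ℕ.* q ℕ.+ p ℕ.* n) m)
    (cong (ℤ._* + m) (cong₂ ℤ._+_ (ℤ.pos-* j q) (ℤ.pos-* p n)))

p<q+r⇒p-r<q : ∀ {p q} r → p ℚ.< q ℚ.+ r → p ℚ.- r ℚ.< q
p<q+r⇒p-r<q {p} {q} r p<q+r = subst (p ℚ.- r ℚ.<_)
  (trans (ℚ.+-assoc q r (ℚ.- r)) (trans (cong (q ℚ.+_) (ℚ.+-inverseʳ r)) (ℚ.+-identityʳ q)))
  (ℚ.+-monoˡ-< (ℚ.- r) p<q+r)

-- A limit is also the limit superior: the upper bound holds from the threshold on, and the lower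
-- bound holds at every index past it, hence at arbitrarily large ones.
converges⇒LimSup : ∀ {s L} →
  (∀ ε → 0ℚ ℚ.< ε → ∃[ m ] ∀ n → m ℕ.≤ n → s n ℚ.< L ℚ.+ ε × L ℚ.< s n ℚ.+ ε) →
  LimSup s L
converges⇒LimSup conv ε 0<ε with k , near ← conv ε 0<ε =
  (k , λ n k≤n → proj₁ (near n k≤n)) ,
  λ m → m ℕ.⊔ k , ℕ.m≤m⊔n m k , p<q+r⇒p-r<q ε (proj₂ (near (m ℕ.⊔ k) (ℕ.m≤n⊔m m k)))

diagonal-density : HasDensity diagonalCode diagonalCode? (+ 1 / 3)
-- The error `4 l` for side `l = 2n + 1` must satisfy `4 l q < 3 l²`, where `q` is the denominator
-- of `ε`. The threshold `2q` gives `l > 4q`, which is enough.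
diagonal-density = converges⇒LimSup λ ε 0<ε → 2 ℕ.* ↧ₙ ε , λ n 2q≤n →
  let N = length (box n)
      T = count diagonalCode? (box n)
      3T≤ : T ℕ.* 3 ℕ.≤ 1 ℕ.* N ℕ.+ side n ℕ.* 4
      3T≤ = subst₂ (λ a b → a ℕ.≤ b ℕ.+ side n ℕ.* 4) (ℕ.*-comm 3 T) (sym (ℕ.*-identityˡ N)) (proj₂ (diagonal-box n))
      N≤ : 1 ℕ.* N ℕ.≤ T ℕ.* 3 ℕ.+ side n ℕ.* 4
      N≤ = subst₂ (λ a b → a ℕ.≤ b ℕ.+ side n ℕ.* 4) (sym (ℕ.*-identityˡ N)) (ℕ.*-comm 3 T) (proj₁ (diagonal-box n))
      small = error-small n (↧ₙ ε) 2q≤n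
  in /-<-/+ε T N 1 3 (side n ℕ.* 4) 0<ε 3T≤ (subst (side n ℕ.* 4 ℕ.* ↧ₙ ε ℕ.<_) (ℕ.*-comm 3 N) small)
   , /-<-/+ε 1 3 T N (side n ℕ.* 4) 0<ε N≤ small
  where
  error-small : ∀ n q → 2 ℕ.* q ℕ.≤ n → side n ℕ.* 4 ℕ.* q ℕ.< 3 ℕ.* length (box n)
  error-small n q 2q≤n = begin-strict
    side n ℕ.* 4 ℕ.* q            ≡⟨ double (side n) q ⟩
    side n ℕ.* (2 ℕ.* q ℕ.+ 2 ℕ.* q) <⟨ ℕ.*-monoʳ-< (side n) (s≤s (ℕ.+-mono-≤ 2q≤n 2q≤n)) ⟩
    side n ℕ.* side n             ≡⟨ length-box n ⟨
    length (box n)                ≤⟨ ℕ.m≤n*m (length (box n)) 3 ⟩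
    3 ℕ.* length (box n)          ∎
    where
    open ℕ.≤-Reasoning
    double : ∀ l q → l ℕ.* 4 ℕ.* q ≡ l ℕ.* (2 ℕ.* q ℕ.+ 2 ℕ.* q)
    double = solveℕ-∀

theorem12 : SelfLocatingDominating diagonalCode × HasDensity diagonalCode diagonalCode? (+ 1 / 3)
theorem12 = diagonal-sld , diagonal-density
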